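{- For every integer $n \geq 5$, $\gamma_{b,2}(C_5 \square C_n) = n$.
   Context: For a graph $G$, a $2$-limited broadcast is a function $f: V(G) \to \{0,1,2\}$. A vertex $u$ hears the broadcast from $v$ if $f(v) > 0$ and $d(u,v) \leq f(v)$, where $d$ is the distance in $G$. The broadcast $f$ is dominating if every vertex of $G$ hears the broadcast from some vertex. The cost of $f$ is $\sum_{v \in V(G)} f(v)$. The $2$-limited broadcast domination number $\gamma_{b,2}(G)$ is the minimum cost of a $2$-limited dominating broadcast on $G$. $C_n$ denotes the cycle on $n$ vertices and $\square$ the Cartesian product of graphs. -}

module Defs where

open import Algebra.Properties.CommutativeMonoid.Sum using (sum)
open import Data.Fin.Base using (Fin; toℕ)
open import Data.Fin.Properties using (*↔×)
open import Data.Nat.Base using (ℕ; zero; suc; _*_; _≤_; _<_; s≤s)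
open import Data.Nat.Properties using (+-0-commutativeMonoid; 1+n≢n)
open import Data.Product.Base using (Σ; ∃; _×_; _,_; proj₁; proj₂)
open import Data.Product.Function.NonDependent.Propositional using (_×-↔_)
open import Data.Sum.Base using (_⊎_; inj₁; inj₂; swap)
open import Level using (0ℓ)
open import Function.Bundles using (_↔_; Inverse)
open import Function.Construct.Composition using (_↔-∘_)
open import Function.Construct.Identity using (↔-id)
open import Function.Construct.Symmetry using (↔-sym)
open import Relation.Binary.Core using (Rel)
open import Relation.Binary.Definitions using (Symmetric)
open import Relation.Binary.PropositionalEquality using (_≡_; refl; sym; trans; cong)
open import Relation.Nullary.Negation using (¬_)
open import Relation.Unary using (Pred)

record FiniteGraph : Set₁ where
  field
    V       : Set
    order   : ℕ
    enum    : Fin order ↔ V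
    _∼_     : Rel V 0ℓ
    ∼-sym   : Symmetric _∼_
    ∼-irrefl : ∀ {v} → ¬ (v ∼ v)

open FiniteGraph public using (V)

IsLeast : ∀ {ℓ} → Pred ℕ ℓ → Pred ℕ ℓ
IsLeast P m = P m × (∀ k → P k → m ≤ k)

module _ (G : FiniteGraph) where
  open FiniteGraph G hiding (V)

  data Walk : V G → V G → ℕ → Set where
    nil  : ∀ {u} → Walk u u zero
    cons : ∀ {u v w k} → u ∼ v → Walk v w k → Walk u w (suc k)

  -- d(u,v) = d.  When u and v lie in different components no d qualifies,
  -- so that d(u,v) = ∞ is then not bounded by any natural number.
  IsDistance : V G → V G → ℕ → Set
  IsDistance u v = IsLeast (Walk u v)

  TwoLimitedBroadcast : Set
  TwoLimitedBroadcast = V G → Fin 3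

  Hears : TwoLimitedBroadcast → V G → V G → Set
  Hears f u v = 0 < toℕ (f v) × ∃ λ d → IsDistance u v d × d ≤ toℕ (f v)

  IsDominating : TwoLimitedBroadcast → Set
  IsDominating f = ∀ u → ∃ λ v → Hears f u v

  cost : TwoLimitedBroadcast → ℕ
  cost f = sum +-0-commutativeMonoid (λ i → toℕ (f (Inverse.to enum i)))

  -- The statement γ_{b,2}(G) = m, as a relation: least elements are unique.
  IsTwoLimitedBroadcastDominationNumber : ℕ → Set
  IsTwoLimitedBroadcastDominationNumber =
    IsLeast (λ c → Σ TwoLimitedBroadcast λ f → IsDominating f × cost f ≡ c)

-- j = i + 1 modulo n
Next : ∀ {n} → Rel (Fin n) 0ℓ
Next {n} i j = suc (toℕ i) ≡ toℕ j ⊎ (suc (toℕ i) ≡ n × toℕ j ≡ 0)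

Cycle : ∀ n → 3 ≤ n → FiniteGraph
Cycle n 3≤n = record
  { V        = Fin n
  ; order    = n
  ; enum     = ↔-id (Fin n)
  ; _∼_      = λ i j → Next i j ⊎ Next j i
  ; ∼-sym    = swap
  ; ∼-irrefl = λ { (inj₁ p) → irr 3≤n p ; (inj₂ p) → irr 3≤n p }
  }
  where
  irr : ∀ {m} → 3 ≤ m → {i : Fin m} → ¬ Next i i
  irr 3≤m (inj₁ e) = 1+n≢n e
  irr 3≤m (inj₂ (e , z)) with trans (sym e) (cong suc z)
  irr (s≤s ()) (inj₂ (e , z)) | refl

infixr 6 _□_

_□_ : FiniteGraph → FiniteGraph → FiniteGraph
G □ H = record
  { V        = V G × V H
  ; order    = G.order * H.order
  ; enum     = (G.enum ×-↔ H.enum) ↔-∘ *↔×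
  ; _∼_      = λ (g , h) (g′ , h′) → (g G.∼ g′ × h ≡ h′) ⊎ (g ≡ g′ × h H.∼ h′)
  ; ∼-sym    = λ { (inj₁ (a , e)) → inj₁ (G.∼-sym a , sym e)
                 ; (inj₂ (e , a)) → inj₂ (sym e , H.∼-sym a) }
  ; ∼-irrefl = λ { (inj₁ (a , _)) → G.∼-irrefl a
                 ; (inj₂ (_ , a)) → H.∼-irrefl a }
  }
  where
  module G = FiniteGraph G
  module H = FiniteGraph H

module Submission where

-- Lower bound, by discharging.  Let c be the power (sum of the broadcast values)
-- of a column and b its number of 2's, so 2b ≤ c.  An empty column is heard
-- only from the adjacent columns, which reach c + b of its vertices, and from
-- those at distance two, which reach b.  Hence both together must reach 5.  Every
-- column of power c ≥ 1 sends (c - 1)/2 to either side, towards the first empty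
-- column within distance two.  A maximal run of k empty columns has k ≤ 4,
-- and in each case the reach inequality makes the two ends pay at least k.
-- The payments are encoded as flows over the edges between consecutive
-- columns; the flows cancel when summed around the cycle.
--
-- Upper bound.  Four columns, with a single 2 in row 0 of the first and in row 2 of the
-- third, form a block of cost 4 which can be repeated, so broadcasts of cost n
-- starting with the block extend from n to n + 4.  Such broadcasts exist for n = 5, 8,
-- 10, 11; the values n = 6, 7 are treated separately.

open import Data.Bool.Base using (if_then_else_)
open import Data.Fin.Base using (Fin; toℕ; fromℕ<; splitAt; remQuot; quotRem)
  renaming (zero to fzero; suc to fsuc)
open import Data.Fin.Patterns
open import Data.Fin.Properties using (all?; any?; toℕ-injective; toℕ-fromℕ<; toℕ<n; toℕ≤pred[n])
  renaming (_≟_ to _≟ᶠ_)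
open import Data.List.Base using (List; []; _∷_; _++_; take)
open import Data.Nat.Base
open import Data.Nat.DivMod
open import Data.Nat.Induction using (<-rec)
open import Data.Nat.Properties
open import Data.Nat.Tactic.RingSolver using (solve-∀)
open import Data.Product.Base as Product using (∃; _×_; _,_; map₂; proj₁; proj₂; swap)
open import Data.Sum.Base as Sum using (_⊎_; inj₁; inj₂; [_,_]′)
open import Defs
open import Function.Base using (_∘_)
open import Function.Bundles using (Inverse)
open import Function.Construct.Symmetry using (↔-sym)
open import Function.Properties.Inverse using (Inverse⇒Injection)
open import Relation.Binary.Definitions using (Decidable)
open import Relation.Binary.PropositionalEquality
open import Relation.Nullary.Decidable
open import Relation.Nullary.Negation using (contradiction)
import Relation.Unary as U
open import Algebra.Properties.CommutativeMonoid.Sum +-0-commutativeMonoid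

-- Flows of surplus power around the cycle

-- Twice what a nonempty column of power c and the column of power c′ behind it
-- pay together to the empty columns in front; the truncation makes an empty
-- column behind contribute nothing.
surplus : ℕ → ℕ → ℕ
surplus c c′ = (c ∸ 1) + (c′ ∸ 1)

-- All payments are doubled.  Both flows are those over the edge between the columns
-- of powers c₂ and c₃.  Inside a run of empty columns a flow of 2 against a
-- surplus stands for the 2 that the first empty column has kept for itself.
rightFlow : (c₀ c₁ c₂ c₃ c₄ : ℕ) → ℕ
rightFlow _ _       zero    (suc _) _       = 0
rightFlow p (suc q) zero    zero    _       = surplus (suc q) p
rightFlow _ zero    zero    zero    (suc _) = 2
rightFlow _ zero    zero    zero    zero    = 0
rightFlow _ q       (suc x) zero    _       = surplus (suc x) q
rightFlow _ _       (suc x) (suc _) zero    = x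
rightFlow _ _       (suc _) (suc _) (suc _) = 0

leftFlow : (c₁ c₂ c₃ c₄ c₅ : ℕ) → ℕ
leftFlow _       (suc _) zero    _       _ = 0
leftFlow _       zero    (suc y) r       _ = surplus (suc y) r
leftFlow (suc _) zero    zero    _       _ = 2
leftFlow zero    zero    zero    (suc r) s = surplus (suc r) s
leftFlow zero    zero    zero    zero    _ = 0
leftFlow zero    (suc _) (suc y) _       _ = y
leftFlow (suc _) (suc _) (suc _) _       _ = 0

-- Of the `2 * suc x` held by a nonempty column, 2 stay and at most `x` leave on either side.
-- Surplus arriving from behind is merely forwarded.
rightFlow-suc : ∀ c₀ c₁ c₂ x c₄ c₅ →
  rightFlow c₁ c₂ (suc x) c₄ c₅ ≤ x + rightFlow c₀ c₁ c₂ (suc x) c₄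
rightFlow-suc _ _ zero    x zero    _       = ≤-refl
rightFlow-suc _ _ (suc _) x zero    _       = ≤-refl
rightFlow-suc _ _ _       x (suc _) zero    = m≤m+n x _
rightFlow-suc _ _ _       x (suc _) (suc _) = z≤n

leftFlow-suc : ∀ c₁ c₂ x c₄ c₅ c₆ →
  leftFlow c₁ c₂ (suc x) c₄ c₅ ≤ x + leftFlow c₂ (suc x) c₄ c₅ c₆
leftFlow-suc _       zero    x zero    _ _ = ≤-refl
leftFlow-suc _       zero    x (suc _) _ _ = ≤-refl
leftFlow-suc zero    (suc _) x _       _ _ = m≤m+n x _
leftFlow-suc (suc _) (suc _) x _       _ _ = z≤n

-- Reach of the ends of an empty run against their surplus

2*m≤n⇒m≤n∸1 : ∀ m n → 2 * m ≤ n → m ≤ n ∸ 1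
2*m≤n⇒m≤n∸1 zero    _       _         = z≤n
2*m≤n⇒m≤n∸1 (suc m) (suc n) (s≤s m+m≤n) =
  ≤-trans (m≤m+n (suc m) (m + 0)) (≤-trans (≤-reflexive (sym (+-suc m (m + 0)))) m+m≤n)

2*m≤0⇒m≡0 : ∀ m → 2 * m ≤ 0 → m ≡ 0
2*m≤0⇒m≡0 zero _ = refl

twos≤surplus : ∀ b x p → 2 * b ≤ suc x → 2 * b ≤ suc (surplus (suc x) p)
twos≤surplus _ x p 2b≤x = ≤-trans 2b≤x (s≤s (m≤m+n x (p ∸ 1)))

-- The left side is twice the reach of one end of an empty run. Weakening `2 * b′ ≤ p` to
-- `b′ ≤ p ∸ 1`, valid also for `p = 0`, bounds the outer column by the power it can spare.
coverage≤surplus : ∀ b b′ x p → 2 * b ≤ suc x → 2 * b′ ≤ p →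
  2 * (suc x + b + b′) ≤ 3 * suc (surplus (suc x) p)
coverage≤surplus b b′ x p 2b≤x 2b′≤p = begin
  2 * (suc x + b + b′)              ≡⟨ expand (suc x) b b′ ⟩
  2 * suc x + 2 * b + 2 * b′        ≤⟨ +-mono-≤ (+-monoʳ-≤ (2 * suc x) 2b≤x)
                                        (≤-trans (*-monoʳ-≤ 2 (2*m≤n⇒m≤n∸1 b′ p 2b′≤p)) (*-monoˡ-≤ (p ∸ 1) (n≤1+n 2))) ⟩
  2 * suc x + suc x + 3 * (p ∸ 1)   ≡⟨ collect x (p ∸ 1) ⟩
  3 * suc (surplus (suc x) p)       ∎
  where
  open ≤-Reasoning
  expand : ∀ x b b′ → 2 * (x + b + b′) ≡ 2 * x + 2 * b + 2 * b′
  expand = solve-∀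
  collect : ∀ x p → 2 * suc x + suc x + 3 * p ≡ 3 * suc (x + p)
  collect = solve-∀

-- In run₁, …, run₄, x and y are the surpluses at the two ends of a maximal run of
-- empty columns, of the length in the name.
run₁ : ∀ S S′ {x y} → 2 * S ≤ 3 * suc x → 2 * S′ ≤ 3 * suc y → 5 ≤ S + S′ → 2 ≤ x + y
run₁ S S′ {x} {y} S≤ S′≤ 5≤ = *-cancelˡ-< 3 1 (x + y) (+-cancelˡ-≤ 6 _ _ (begin
  2 * 5                  ≤⟨ *-monoʳ-≤ 2 5≤ ⟩
  2 * (S + S′)           ≡⟨ *-distribˡ-+ 2 S S′ ⟩
  2 * S + 2 * S′         ≤⟨ +-mono-≤ S≤ S′≤ ⟩
  3 * suc x + 3 * suc y  ≡⟨ collect x y ⟩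
  6 + 3 * (x + y)        ∎))
  where
  open ≤-Reasoning
  collect : ∀ x y → 3 * suc x + 3 * suc y ≡ 6 + 3 * (x + y)
  collect = solve-∀

-- In a run of two, an empty column gets the full reach `S` of the adjacent end, but only the `b′`
-- many 2's of the other end, which is at distance two.
run₂-half : ∀ S b′ {x y} → 2 * S ≤ 3 * suc x → 2 * b′ ≤ suc y → 5 ≤ S + b′ → 6 ≤ 3 * x + y
run₂-half S b′ {x} {y} S≤ b′≤ 5≤ = +-cancelˡ-≤ 4 _ _ (begin
  2 * 5                  ≤⟨ *-monoʳ-≤ 2 5≤ ⟩
  2 * (S + b′)           ≡⟨ *-distribˡ-+ 2 S b′ ⟩
  2 * S + 2 * b′         ≤⟨ +-mono-≤ S≤ b′≤ ⟩
  3 * suc x + suc y      ≡⟨ collect x y ⟩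
  4 + (3 * x + y)        ∎)
  where
  open ≤-Reasoning
  collect : ∀ x y → 3 * suc x + suc y ≡ 4 + (3 * x + y)
  collect = solve-∀

run₂ : ∀ x y → 6 ≤ 3 * x + y → 6 ≤ 3 * y + x → 4 ≤ x + y
-- Adding the hypotheses yields only `x + y ≥ 3`. The value 3 is excluded by integrality: the
-- smaller summand is then at most 1, so one of the left-hand combinations is at most 5.
run₂ 0 y p _ = ≤-trans (m≤n+m 4 2) p
run₂ 1 y p _ = s≤s (+-cancelˡ-≤ 3 _ _ p)
run₂ 2 y _ q = s≤s (s≤s (*-cancelˡ-< 3 1 y (+-cancelʳ-≤ 2 _ _ q)))
run₂ 3 y _ q = s≤s (s≤s (s≤s (*-cancelˡ-< 3 0 y (≤-trans (m≤n+m 1 2) (+-cancelʳ-≤ 3 _ _ q)))))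
run₂ (suc (suc (suc (suc x)))) y _ _ = s≤s (s≤s (s≤s (s≤s z≤n)))

run₃ : ∀ b b′ {x y} → 2 * b ≤ suc x → 2 * b′ ≤ suc y → 5 ≤ b + b′ → 8 ≤ x + y
run₃ b b′ {x} {y} b≤ b′≤ 5≤ = +-cancelˡ-≤ 2 _ _ (begin
  2 * 5            ≤⟨ *-monoʳ-≤ 2 5≤ ⟩
  2 * (b + b′)     ≡⟨ *-distribˡ-+ 2 b b′ ⟩
  2 * b + 2 * b′   ≤⟨ +-mono-≤ b≤ b′≤ ⟩
  suc x + suc y    ≡⟨ cong suc (+-suc x y) ⟩
  2 + (x + y)      ∎)
  where open ≤-Reasoning

run₄ : ∀ b {x} → 2 * b ≤ suc x → 5 ≤ b → 4 ≤ x
run₄ _ b≤ 5≤ = ≤-trans (m≤n+m 4 5) (≤-pred (≤-trans (*-monoʳ-≤ 2 5≤) b≤))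

-- Balance at column 3: its doubled power and the inflow pay for the outflow and for a charge of 2,
-- the doubled unit due from every column.
flow-balance : ∀ c₀ c₁ c₂ c₃ c₄ c₅ c₆ b₀ b₁ b₂ b₃ b₄ b₅ →
  2 * b₀ ≤ c₀ → 2 * b₁ ≤ c₁ → 2 * b₂ ≤ c₂ → 2 * b₃ ≤ c₃ → 2 * b₄ ≤ c₄ → 2 * b₅ ≤ c₅ →
  (c₂ ≡ 0 → 5 ≤ (c₁ + b₁ + b₀) + (c₃ + b₃ + b₄)) →
  (c₃ ≡ 0 → 5 ≤ (c₂ + b₂ + b₁) + (c₄ + b₄ + b₅)) →
  2 + rightFlow c₁ c₂ c₃ c₄ c₅ + leftFlow c₁ c₂ c₃ c₄ c₅ ≤
  2 * c₃ + rightFlow c₀ c₁ c₂ c₃ c₄ + leftFlow c₂ c₃ c₄ c₅ c₆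
flow-balance c₀ c₁ c₂ (suc x) c₄ c₅ c₆ _ _ _ _ _ _ _ _ _ _ _ _ _ _ = begin
  2 + rightFlow c₁ c₂ (suc x) c₄ c₅ + leftFlow c₁ c₂ (suc x) c₄ c₅
    ≤⟨ +-mono-≤ (+-monoʳ-≤ 2 (rightFlow-suc c₀ c₁ c₂ x c₄ c₅)) (leftFlow-suc c₁ c₂ x c₄ c₅ c₆) ⟩
  2 + (x + R) + (x + L)
    ≡⟨ collect x R L ⟩
  2 * suc x + R + L ∎
  where
  open ≤-Reasoning
  R = rightFlow c₀ c₁ c₂ (suc x) c₄
  L = leftFlow c₂ (suc x) c₄ c₅ c₆
  collect : ∀ x R L → 2 + (x + R) + (x + L) ≡ 2 * suc x + R + L
  collect = solve-∀
flow-balance _ c₁ (suc x) zero (suc y) c₅ _ _ b₁ b₂ _ b₄ b₅ _ e₁ e₂ _ e₄ e₅ _ cov =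
  run₁ (suc x + b₂ + b₁) (suc y + b₄ + b₅)
    (coverage≤surplus b₂ b₁ x c₁ e₂ e₁) (coverage≤surplus b₄ b₅ y c₅ e₄ e₅) (cov refl)
-- The first empty column of a longer run lets the whole surplus through; the 2 it keeps is booked
-- as a leftward flow from its right neighbour.
flow-balance _ _ (suc x) zero zero _ _ _ _ _ _ _ _ _ _ _ _ _ _ _ _ =
  ≤-reflexive (trans (+-identityʳ _) (+-comm 2 _))
flow-balance _ zero zero zero (suc y) _ _ _ _ _ _ _ _ _ _ _ _ _ _ _ _ = ≤-refl
-- A run of two is settled at its right column, which owes its own 2 and the 2 kept by the left one.
-- The coverage of both columns enters.
flow-balance c₀ (suc x) zero zero (suc y) c₅ _ b₀ b₁ b₂ b₃ b₄ b₅ e₀ e₁ e₂ e₃ e₄ e₅ cov₂ cov₃ =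
  run₂ (surplus (suc x) c₀) (surplus (suc y) c₅)
    (run₂-half (suc x + b₁ + b₀) b₄ (coverage≤surplus b₁ b₀ x c₀ e₁ e₀) (twos≤surplus b₄ y c₅ e₄)
      (subst (λ b → 5 ≤ (suc x + b₁ + b₀) + (b + b₄)) (2*m≤0⇒m≡0 b₃ e₃) (cov₂ refl)))
    (run₂-half (suc y + b₄ + b₅) b₁ (coverage≤surplus b₄ b₅ y c₅ e₄ e₅) (twos≤surplus b₁ x c₀ e₁)
      (subst (5 ≤_) (+-comm b₁ _)
        (subst (λ b → 5 ≤ (b + b₁) + (suc y + b₄ + b₅)) (2*m≤0⇒m≡0 b₂ e₂) (cov₃ refl))))
-- With both neighbours empty, only 2's at distance two reach the column. It is the middle of a run
-- of three, or second from one end of a longer run, or out of reach of all power, which is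
-- impossible.
flow-balance c₀ c₁ zero zero zero c₅ c₆ _ b₁ b₂ _ b₄ b₅ _ e₁ e₂ _ e₄ e₅ _ cov =
  far c₁ c₅ e₁ e₅ (subst₂ (λ b b′ → 5 ≤ (b + b₁) + (b′ + b₅))
    (2*m≤0⇒m≡0 b₂ e₂) (2*m≤0⇒m≡0 b₄ e₄) (cov refl))
  where
  far : ∀ c₁ c₅ → 2 * b₁ ≤ c₁ → 2 * b₅ ≤ c₅ → 5 ≤ b₁ + b₅ →
    2 + rightFlow c₁ 0 0 0 c₅ + leftFlow c₁ 0 0 0 c₅ ≤
    rightFlow c₀ c₁ 0 0 0 + leftFlow 0 0 0 c₅ c₆
  far (suc x) (suc y) e₁ e₅ 5≤ = ≤-trans (m≤n+m 6 2)
    (run₃ b₁ b₅ (twos≤surplus b₁ x c₀ e₁) (twos≤surplus b₅ y c₆ e₅) 5≤)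
  far (suc x) zero e₁ e₅ 5≤ rewrite 2*m≤0⇒m≡0 b₅ e₅ =
    subst (4 ≤_) (sym (+-identityʳ _))
      (run₄ b₁ (twos≤surplus b₁ x c₀ e₁) (subst (5 ≤_) (+-identityʳ b₁) 5≤))
  far zero (suc y) e₁ e₅ 5≤ rewrite 2*m≤0⇒m≡0 b₁ e₁ = run₄ b₅ (twos≤surplus b₅ y c₆ e₅) 5≤
  far zero zero e₁ e₅ 5≤ rewrite 2*m≤0⇒m≡0 b₁ e₁ | 2*m≤0⇒m≡0 b₅ e₅ = contradiction 5≤ λ ()

-- Summation around the cycle

sum-rotate : ∀ n (h : ℕ → ℕ) →
  ∑[ i < n ] h (suc (toℕ i)) + h 0 ≡ ∑[ i < n ] h (toℕ i) + h n
sum-rotate zero    h = refl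
sum-rotate (suc n) h = begin
  h 1 + ∑[ i < n ] h (suc (suc (toℕ i))) + h 0   ≡⟨ cong (_+ h 0) (+-comm (h 1) _) ⟩
  ∑[ i < n ] h (suc (suc (toℕ i))) + h 1 + h 0   ≡⟨ cong (_+ h 0) (sum-rotate n (λ i → h (suc i))) ⟩
  ∑[ i < n ] h (suc (toℕ i)) + h (suc n) + h 0   ≡⟨ rearrange (∑[ i < n ] h (suc (toℕ i))) (h (suc n)) (h 0) ⟩
  h 0 + ∑[ i < n ] h (suc (toℕ i)) + h (suc n)   ∎
  where
  open ≡-Reasoning
  rearrange : ∀ a b c → a + b + c ≡ c + a + b
  rearrange = solve-∀

sum-shift : ∀ n k (h : ℕ → ℕ) → (∀ i → h (n + i) ≡ h i) →
  ∑[ i < n ] h (k + toℕ i) ≡ ∑[ i < n ] h (toℕ i)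
sum-shift n zero    h periodic = refl
sum-shift n (suc k) h periodic = begin
  ∑[ i < n ] h (suc (k + toℕ i))   ≡⟨ sum-cong-≗ {n} (λ i → cong h (sym (+-suc k (toℕ i)))) ⟩
  ∑[ i < n ] h (k + suc (toℕ i))   ≡⟨ +-cancelʳ-≡ (h (k + 0)) _ _ rotate ⟩
  ∑[ i < n ] h (k + toℕ i)         ≡⟨ sum-shift n k h periodic ⟩
  ∑[ i < n ] h (toℕ i)             ∎
  where
  open ≡-Reasoning
  wrap : h (k + n) ≡ h (k + 0)
  wrap = trans (cong h (+-comm k n)) (trans (periodic k) (cong h (sym (+-identityʳ k))))
  rotate : ∑[ i < n ] h (k + suc (toℕ i)) + h (k + 0) ≡ ∑[ i < n ] h (k + toℕ i) + h (k + 0)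
  rotate = trans (sum-rotate n (λ i → h (k + i))) (cong (∑[ i < n ] h (k + toℕ i) +_) wrap)

-- Flows over interior edges occur on both sides and cancel, leaving those over the two boundary
-- edges.
telescope : ∀ (c R L : ℕ → ℕ) →
  (∀ j → 2 + R (suc j) + L j ≤ 2 * c j + R j + L (suc j)) →
  ∀ n → 2 * n + R n + L 0 ≤ 2 * (∑[ i < n ] c (toℕ i)) + R 0 + L n
telescope c R L step zero    = ≤-refl
telescope c R L step (suc n) = +-cancelʳ-≤ (R 1 + L 1) _ _ (begin
  2 * suc n + R (suc n) + L 0 + (R 1 + L 1)             ≡⟨ left n (R (suc n)) (L 0) (R 1) (L 1) ⟩
  (2 * n + R (suc n) + L 1) + (2 + R 1 + L 0)
    ≤⟨ +-mono-≤ (telescope (λ j → c (suc j)) (λ j → R (suc j)) (λ j → L (suc j)) (λ j → step (suc j)) n) (step 0) ⟩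
  (2 * C + R 1 + L (suc n)) + (2 * c 0 + R 0 + L 1)     ≡⟨ right C (R 1) (L (suc n)) (c 0) (R 0) (L 1) ⟩
  2 * (c 0 + C) + R 0 + L (suc n) + (R 1 + L 1)         ∎)
  where
  open ≤-Reasoning
  C = ∑[ i < n ] c (suc (toℕ i))
  left : ∀ n Rₙ L₀ R₁ L₁ → 2 * suc n + Rₙ + L₀ + (R₁ + L₁) ≡ (2 * n + Rₙ + L₁) + (2 + R₁ + L₀)
  left = solve-∀
  right : ∀ C R₁ Lₙ c₀ R₀ L₁ →
    (2 * C + R₁ + Lₙ) + (2 * c₀ + R₀ + L₁) ≡ 2 * (c₀ + C) + R₀ + Lₙ + (R₁ + L₁)
  right = solve-∀

periodic-cost≥ : ∀ n (c b : ℕ → ℕ) → (∀ j → c (n + j) ≡ c j) → (∀ j → 2 * b j ≤ c j) →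
  (∀ j → c (2 + j) ≡ 0 → 5 ≤ (c (1 + j) + b (1 + j) + b j) + (c (3 + j) + b (3 + j) + b (4 + j))) →
  n ≤ ∑[ i < n ] c (toℕ i)
-- The balance with index `j` concerns column `3 + j`, which keeps all indices natural; periodicity
-- undoes the shift by 3.
periodic-cost≥ n c b periodic 2b≤c cov = subst (n ≤_) (sum-shift n 3 c periodic)
  (*-cancelˡ-≤ 2 (+-cancelʳ-≤ (R 0 + L 0) _ _ (begin
    2 * n + (R 0 + L 0)                             ≡⟨ sym (+-assoc (2 * n) (R 0) (L 0)) ⟩
    2 * n + R 0 + L 0                               ≡⟨ cong (λ r → 2 * n + r + L 0) (sym R-wrap) ⟩
    2 * n + R n + L 0                               ≤⟨ telescope (λ j → c (3 + j)) R L step n ⟩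
    2 * (∑[ i < n ] c (3 + toℕ i)) + R 0 + L n      ≡⟨ cong (2 * (∑[ i < n ] c (3 + toℕ i)) + R 0 +_) L-wrap ⟩
    2 * (∑[ i < n ] c (3 + toℕ i)) + R 0 + L 0      ≡⟨ +-assoc (2 * (∑[ i < n ] c (3 + toℕ i))) (R 0) (L 0) ⟩
    2 * (∑[ i < n ] c (3 + toℕ i)) + (R 0 + L 0)    ∎)))
  where
  open ≤-Reasoning
  R L : ℕ → ℕ
  R j = rightFlow (c j) (c (1 + j)) (c (2 + j)) (c (3 + j)) (c (4 + j))
  L j = leftFlow (c (1 + j)) (c (2 + j)) (c (3 + j)) (c (4 + j)) (c (5 + j))

  step : ∀ j → 2 + R (suc j) + L j ≤ 2 * c (3 + j) + R j + L (suc j)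
  step j = flow-balance (c j) (c (1 + j)) (c (2 + j)) (c (3 + j)) (c (4 + j)) (c (5 + j)) (c (6 + j))
    (b j) (b (1 + j)) (b (2 + j)) (b (3 + j)) (b (4 + j)) (b (5 + j))
    (2b≤c j) (2b≤c (1 + j)) (2b≤c (2 + j)) (2b≤c (3 + j)) (2b≤c (4 + j)) (2b≤c (5 + j))
    (cov j) (cov (suc j))

  wrap : ∀ k → c (k + n) ≡ c k
  wrap k = trans (cong c (+-comm k n)) (periodic k)

  R-wrap : R n ≡ R 0
  R-wrap rewrite wrap 0 | wrap 1 | wrap 2 | wrap 3 | wrap 4 = refl

  L-wrap : L n ≡ L 0
  L-wrap rewrite wrap 1 | wrap 2 | wrap 3 | wrap 4 | wrap 5 = refl

-- Finite graphs and cycles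

module _ (G : FiniteGraph) (_∼?_ : Decidable (FiniteGraph._∼_ G)) where
  open FiniteGraph G hiding (V)

  _≟ᵛ_ : Decidable {A = V G} _≡_
  _≟ᵛ_ = via-injection (Inverse⇒Injection (↔-sym enum)) _≟ᶠ_

  anyVertex? : ∀ {P : V G → Set} → U.Decidable P → Dec (∃ P)
  anyVertex? {P} P? = map′ (λ (i , p) → Inverse.to enum i , p)
    (λ (v , p) → Inverse.from enum v , subst P (sym (Inverse.strictlyInverseˡ enum v)) p)
    (any? (P? ∘ Inverse.to enum))

  walk? : ∀ k u v → Dec (Walk G u v k)
  walk? zero    u v = map′ (λ { refl → nil }) (λ { nil → refl }) (u ≟ᵛ v)
  walk? (suc k) u w = map′ (λ (_ , e , p) → cons e p) (λ { (cons e p) → _ , e , p })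
    (anyVertex? (λ v → (u ∼? v) ×-dec walk? k v w))

  -- `IsDistance` demands a least length, so exhibiting a walk is not enough. Walks of given length
  -- are decidable, and strong induction descends to a shortest one.
  walk⇒distance≤ : ∀ {u v} k → Walk G u v k → ∃ λ d → IsDistance G u v d × d ≤ k
  walk⇒distance≤ {u} {v} = <-rec _ λ k shorter p → least k shorter p
    where
    least : ∀ k → (∀ {m} → m < k → Walk G u v m → ∃ λ d → IsDistance G u v d × d ≤ m) →
            Walk G u v k → ∃ λ d → IsDistance G u v d × d ≤ k
    least k shorter p with anyUpTo? (λ m → walk? m u v) k
    ... | yes (m , m<k , q) = map₂ (map₂ (λ d≤m → ≤-trans d≤m (<⇒≤ m<k))) (shorter m<k q)
    ... | no none = k , (p , λ m q → ≮⇒≥ (λ m<k → none (m , m<k , q))) , ≤-refl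

next? : ∀ {n} → Decidable (Next {n})
next? {n} i j = (suc (toℕ i) ≟ toℕ j) ⊎-dec ((suc (toℕ i) ≟ n) ×-dec (toℕ j ≟ 0))

Adjacent : ∀ {n} → Fin n → Fin n → Set
Adjacent i j = Next i j ⊎ Next j i

adjacent? : ∀ {n} → Decidable (Adjacent {n})
adjacent? i j = next? i j ⊎-dec next? j i

Next-functional : ∀ {n} {i j k : Fin n} → Next i j → Next i k → j ≡ k
Next-functional (inj₁ p) (inj₁ q) = toℕ-injective (trans (sym p) q)
Next-functional {j = j} (inj₁ p) (inj₂ (q , _)) = contradiction (trans (sym p) q) (<⇒≢ (toℕ<n j))
Next-functional {k = k} (inj₂ (p , _)) (inj₁ q) = contradiction (trans (sym q) p) (<⇒≢ (toℕ<n k))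
Next-functional (inj₂ (_ , p)) (inj₂ (_ , q)) = toℕ-injective (trans p (sym q))

Next-injective : ∀ {n} {i j k : Fin n} → Next i k → Next j k → i ≡ j
Next-injective (inj₁ p) (inj₁ q) = toℕ-injective (suc-injective (trans p (sym q)))
Next-injective (inj₁ p) (inj₂ (_ , q)) = contradiction (trans p q) λ ()
Next-injective (inj₂ (_ , p)) (inj₁ q) = contradiction (trans q p) λ ()
Next-injective (inj₂ (p , _)) (inj₂ (q , _)) = toℕ-injective (suc-injective (trans p (sym q)))

module _ (n : ℕ) .{{_ : NonZero n}} where

  toℕ-mod : ∀ j → toℕ (j mod n) ≡ j % n
  toℕ-mod j = toℕ-fromℕ< (m%n<n j n)

  mod-cong : ∀ {i j} → i % n ≡ j % n → i mod n ≡ j mod n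
  mod-cong eq = toℕ-injective (trans (toℕ-mod _) (trans eq (sym (toℕ-mod _))))

  toℕ-mod-inverse : ∀ (i : Fin n) → toℕ i mod n ≡ i
  toℕ-mod-inverse i = toℕ-injective (trans (toℕ-mod (toℕ i)) (m<n⇒m%n≡m (toℕ<n i)))

  [n+m]mod-n : ∀ j → (n + j) mod n ≡ j mod n
  [n+m]mod-n j = mod-cong (trans (cong (_% n) (+-comm n j)) ([m+n]%n≡m%n j n))

  suc-% : ∀ j → suc j % n ≡ suc (j % n) % n
  suc-% j = trans (cong (λ k → suc k % n) (m≡m%n+[m/n]*n j n)) ([m+kn]%n≡m%n (suc (j % n)) (j / n) n)

  Next-mod : ∀ j → Next (j mod n) (suc j mod n)
  Next-mod j with m≤n⇒m<n∨m≡n (m%n<n j n)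
  ... | inj₁ 1+j<n = inj₁ (trans (cong suc (toℕ-mod j))
                       (sym (trans (toℕ-mod (suc j)) (trans (suc-% j) (m<n⇒m%n≡m 1+j<n)))))
  ... | inj₂ 1+j≡n = inj₂ (trans (cong suc (toℕ-mod j)) 1+j≡n ,
                       trans (toℕ-mod (suc j)) (trans (suc-% j) (trans (cong (_% n) 1+j≡n) (n%n≡0 n))))

-- Hearing within five consecutive columns

-- The length of the shorter arc, that is, the distance in the 5-cycle: `d₅-adjacent` prevents
-- shorter walks and `d₅-walk` attains it.
d₅ : Fin 5 → Fin 5 → ℕ
d₅ r s = ∣ toℕ r - toℕ s ∣ ⊓ (5 ∸ ∣ toℕ r - toℕ s ∣)

d₅-refl : ∀ r → d₅ r r ≡ 0
d₅-refl = from-yes (all? λ r → d₅ r r ≟ 0)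

d₅-adjacent : ∀ r r′ s → Adjacent r r′ → d₅ r s ≤ suc (d₅ r′ s)
d₅-adjacent = from-yes (all? λ r → all? λ r′ → all? λ s → adjacent? r r′ →-dec (d₅ r s ≤? suc (d₅ r′ s)))

C₅ : FiniteGraph
C₅ = Cycle 5 (m≤m+n 3 2)

d₅-walk : ∀ r s → Walk C₅ r s (d₅ r s)
d₅-walk = from-yes (all? λ r → all? λ s → walk? C₅ adjacent? (d₅ r s) r s)

∣-∣-step : ∀ m n → ∣ m - n ∣ ≤ suc ∣ suc m - n ∣
∣-∣-step zero zero = z≤n
∣-∣-step zero (suc n) = ≤-refl
∣-∣-step (suc m) zero = s≤s (m≤n+m m 2)
∣-∣-step (suc m) (suc n) = ∣-∣-step m n

∣-∣-step′ : ∀ m n → ∣ suc m - n ∣ ≤ suc ∣ m - n ∣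
∣-∣-step′ zero zero = ≤-refl
∣-∣-step′ zero (suc n) = m≤n+m n 2
∣-∣-step′ (suc m) zero = ≤-refl
∣-∣-step′ (suc m) (suc n) = ∣-∣-step′ m n

Column : Set
Column = Fin 5 → Fin 3

Reaches : ℕ → Fin 3 → Set
Reaches d v = 0 < toℕ v × d ≤ toℕ v

reaches? : ∀ d v → Dec (Reaches d v)
reaches? d v = (0 <? toℕ v) ×-dec (d ≤? toℕ v)

offset : Fin 5 → ℕ
offset o = ∣ 2 - toℕ o ∣

-- A window is five consecutive columns; hearing is asked of its middle column.
Window : Set
Window = Fin 5 → Column

-- Distance is measured in the unrolled strip instead of the torus; `hears⇒heard` and `heard⇒hears`
-- translate between the two.
Heard : Window → Fin 5 → Set
Heard w r = ∃ λ o → ∃ λ s → Reaches (offset o + d₅ r s) (w o s)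

heard? : ∀ w r → Dec (Heard w r)
heard? w r = any? λ o → any? λ s → reaches? (offset o + d₅ r s) (w o s)

window : (ℕ → Column) → ℕ → Window
window col j o = col (toℕ o + j)

-- Finite sums and double counting in a window

sum-splitAt : ∀ m n (h : Fin m ⊎ Fin n → ℕ) →
  ∑[ i < m + n ] h (splitAt m i) ≡ ∑[ i < m ] h (inj₁ i) + ∑[ j < n ] h (inj₂ j)
sum-splitAt zero    n h = refl
sum-splitAt (suc m) n h = trans (cong (h (inj₁ fzero) +_) (sum-splitAt m n (h ∘ Sum.map₁ fsuc)))
  (sym (+-assoc (h (inj₁ fzero)) _ _))

-- `remQuot` underlies the enumeration of a product graph, so this turns its cost into a double sum.
sum-remQuot : ∀ m n (g : Fin m × Fin n → ℕ) →
  ∑[ i < m * n ] g (remQuot {m} n i) ≡ ∑[ i < m ] ∑[ j < n ] g (i , j)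
sum-remQuot zero    n g = refl
sum-remQuot (suc m) n g = trans
  (sum-splitAt n (m * n) (g ∘ swap ∘ [ (_, fzero) , map₂ fsuc ∘ quotRem {m} n ]′))
  (cong (∑[ j < n ] g (fzero , j) +_) (sum-remQuot m n (g ∘ Product.map₁ fsuc)))

sum-mono-≤ : ∀ {n} {f g : Fin n → ℕ} → (∀ i → f i ≤ g i) → sum f ≤ sum g
sum-mono-≤ {zero}  f≤g = z≤n
sum-mono-≤ {suc n} f≤g = +-mono-≤ (f≤g fzero) (sum-mono-≤ (f≤g ∘ fsuc))

term≤sum : ∀ {n} (f : Fin n → ℕ) i → f i ≤ sum f
term≤sum f fzero    = m≤m+n (f fzero) _
term≤sum f (fsuc i) = ≤-trans (term≤sum (f ∘ fsuc) i) (m≤n+m _ (f fzero))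

power : Column → ℕ
power x = ∑[ s < 5 ] toℕ (x s)

two : Fin 3 → ℕ
two 0F = 0
two 1F = 0
two 2F = 1

twos : Column → ℕ
twos x = ∑[ s < 5 ] two (x s)

2*twos≤power : ∀ x → 2 * twos x ≤ power x
2*twos≤power x = begin
  2 * twos x             ≡⟨ cong (twos x +_) (+-identityʳ (twos x)) ⟩
  twos x + twos x        ≡⟨ ∑-distrib-+ (two ∘ x) (two ∘ x) ⟨
  ∑[ s < 5 ] (two (x s) + two (x s)) ≤⟨ sum-mono-≤ (double ∘ x) ⟩
  power x ∎
  where
  open ≤-Reasoning
  double : ∀ v → two v + two v ≤ toℕ v
  double = from-yes (all? λ v → two v + two v ≤? toℕ v)

indicator : ℕ → Fin 3 → ℕ
indicator d v = if does (reaches? d v) then 1 else 0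

-- The value at 2F matters only for v = 0, so a crude bound suffices there.
ball : Fin 5 → Fin 3 → ℕ
ball 0F v = two v
ball 1F v = toℕ v + two v
ball 2F v = 3 * toℕ v
ball 3F v = toℕ v + two v
ball 4F v = two v

indicator≤ball : ∀ o s v → ∑[ r < 5 ] indicator (offset o + d₅ r s) v ≤ ball o v
indicator≤ball = from-yes (all? λ o → all? λ s → all? λ v →
  ∑[ r < 5 ] indicator (offset o + d₅ r s) v ≤? ball o v)

heard⇒1≤ : ∀ w r → Heard w r → 1 ≤ ∑[ o < 5 ] ∑[ s < 5 ] indicator (offset o + d₅ r s) (w o s)
heard⇒1≤ w r (o , s , h) = begin
  1                                       ≡⟨ cong (if_then 1 else 0) (dec-true (reaches? _ _) h) ⟨
  indicator (offset o + d₅ r s) (w o s)   ≤⟨ term≤sum (λ s → indicator (offset o + d₅ r s) (w o s)) s ⟩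
  ∑[ s < 5 ] indicator (offset o + d₅ r s) (w o s)
    ≤⟨ term≤sum (λ o → ∑[ s < 5 ] indicator (offset o + d₅ r s) (w o s)) o ⟩
  ∑[ o < 5 ] ∑[ s < 5 ] indicator (offset o + d₅ r s) (w o s) ∎
  where open ≤-Reasoning

-- Double counting of pairs of a middle vertex and a source it hears: every middle vertex lies in at
-- least one pair, every source in at most `ball` many.
5≤balls : ∀ w → (∀ r → Heard w r) → 5 ≤ ∑[ o < 5 ] ∑[ s < 5 ] ball o (w o s)
5≤balls w h = begin
  5                                                    ≤⟨ sum-mono-≤ (λ r → heard⇒1≤ w r (h r)) ⟩
  ∑[ r < 5 ] ∑[ o < 5 ] ∑[ s < 5 ] ind o s r           ≡⟨ ∑-comm (λ r o → ∑[ s < 5 ] ind o s r) ⟩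
  ∑[ o < 5 ] ∑[ r < 5 ] ∑[ s < 5 ] ind o s r           ≡⟨ sum-cong-≗ (λ o → ∑-comm (λ r s → ind o s r)) ⟩
  ∑[ o < 5 ] ∑[ s < 5 ] ∑[ r < 5 ] ind o s r           ≤⟨ sum-mono-≤ (λ o → sum-mono-≤ (λ s → indicator≤ball o s (w o s))) ⟩
  ∑[ o < 5 ] ∑[ s < 5 ] ball o (w o s)                 ∎
  where
  open ≤-Reasoning
  ind : Fin 5 → Fin 5 → Fin 5 → ℕ
  ind o s r = indicator (offset o + d₅ r s) (w o s)

sum≡0⇒≡0 : ∀ {n} (f : Fin n → ℕ) → sum f ≡ 0 → ∀ i → f i ≡ 0
sum≡0⇒≡0 f eq i = n≤0⇒n≡0 (subst (f i ≤_) eq (term≤sum f i))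

coverage : ∀ w → (∀ r → Heard w r) → power (w 2F) ≡ 0 →
  5 ≤ (power (w 1F) + twos (w 1F) + twos (w 0F)) + (power (w 3F) + twos (w 3F) + twos (w 4F))
coverage w h empty = begin
  5                                     ≤⟨ 5≤balls w h ⟩
  ∑[ o < 5 ] ∑[ s < 5 ] ball o (w o s)
    ≡⟨ cong₂ _+_ (refl {x = twos (w 0F)}) (cong₂ _+_ (side 1F) (cong₂ _+_ middle (cong₂ _+_ (side 3F) refl))) ⟩
  twos (w 0F) + ((power (w 1F) + twos (w 1F)) + (0 + ((power (w 3F) + twos (w 3F)) + (twos (w 4F) + 0))))
    ≡⟨ rearrange (twos (w 0F)) (power (w 1F) + twos (w 1F)) (power (w 3F) + twos (w 3F)) (twos (w 4F)) ⟩
  (power (w 1F) + twos (w 1F) + twos (w 0F)) + (power (w 3F) + twos (w 3F) + twos (w 4F)) ∎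
  where
  open ≤-Reasoning
  side : ∀ o → ∑[ s < 5 ] (toℕ (w o s) + two (w o s)) ≡ power (w o) + twos (w o)
  side o = ∑-distrib-+ (toℕ ∘ w o) (two ∘ w o)
  middle : ∑[ s < 5 ] (3 * toℕ (w 2F s)) ≡ 0
  middle = sum-cong-≗ (λ s → cong (3 *_) (sum≡0⇒≡0 (toℕ ∘ w 2F) empty s))
  rearrange : ∀ a b c d → a + (b + (0 + (c + (d + 0)))) ≡ (b + a) + (c + d)
  rearrange = solve-∀

-- The torus C₅ □ Cₙ

module Torus (n : ℕ) (3≤n : 3 ≤ n) where

  instance
    n≢0 : NonZero n
    n≢0 = >-nonZero (≤-trans (m≤m+n 1 2) 3≤n)

  T : FiniteGraph
  T = C₅ □ Cycle n 3≤n

  _∼?_ : Decidable (FiniteGraph._∼_ T)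
  (r , i) ∼? (s , j) = (adjacent? r s ×-dec (i ≟ᶠ j)) ⊎-dec ((r ≟ᶠ s) ×-dec adjacent? i j)

  column : TwoLimitedBroadcast T → ℕ → Column
  column f j r = f (r , j mod n)

  cost≡∑power : ∀ f → cost T f ≡ ∑[ j < n ] power (column f (toℕ j))
  cost≡∑power f = begin
    cost T f                                       ≡⟨ sum-remQuot 5 n (toℕ ∘ f) ⟩
    ∑[ r < 5 ] ∑[ j < n ] toℕ (f (r , j))          ≡⟨ ∑-comm (λ r j → toℕ (f (r , j))) ⟩
    ∑[ j < n ] ∑[ r < 5 ] toℕ (f (r , j))
      ≡⟨ sum-cong-≗ (λ j → sum-cong-≗ (λ r → cong (λ k → toℕ (f (r , k))) (sym (toℕ-mod-inverse n j)))) ⟩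
    ∑[ j < n ] power (column f (toℕ j))            ∎
    where open ≡-Reasoning

  -- Lifts a walk from the cycle of columns to the naturals, where the position changes by at most
  -- one per step. By `d ≤ J`, steps to the left never pass 0.
  walk-end : ∀ {r k s d} J → d ≤ J → Walk T (r , J mod n) (s , k) d →
    ∃ λ J′ → k ≡ J′ mod n × ∣ J - J′ ∣ + d₅ r s ≤ d
  walk-end {r} J _ nil = J , refl , ≤-reflexive (cong₂ _+_ (∣n-n∣≡0 J) (d₅-refl r))
  walk-end {r} {s = s} J d<J (cons {v = r′ , _} (inj₁ (a , refl)) p)
    with J′ , eq , bound ← walk-end J (<⇒≤ d<J) p = J′ , eq , (begin
      ∣ J - J′ ∣ + d₅ r s          ≤⟨ +-monoʳ-≤ ∣ J - J′ ∣ (d₅-adjacent r r′ s a) ⟩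
      ∣ J - J′ ∣ + suc (d₅ r′ s)   ≡⟨ +-suc ∣ J - J′ ∣ (d₅ r′ s) ⟩
      suc (∣ J - J′ ∣ + d₅ r′ s)   ≤⟨ s≤s bound ⟩
      _                            ∎)
    where open ≤-Reasoning
  walk-end {r} {s = s} J d<J (cons (inj₂ (refl , inj₁ a)) p)
    with refl ← Next-functional a (Next-mod n J)
    with J′ , eq , bound ← walk-end (suc J) (m≤n⇒m≤1+n (<⇒≤ d<J)) p = J′ , eq ,
      ≤-trans (+-monoˡ-≤ (d₅ r s) (∣-∣-step J J′)) (s≤s bound)
  walk-end {r} {s = s} (suc J) (s≤s d≤J) (cons (inj₂ (refl , inj₂ a)) p)
    with refl ← Next-injective a (Next-mod n J)
    with J′ , eq , bound ← walk-end J d≤J p = J′ , eq ,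
      ≤-trans (+-monoˡ-≤ (d₅ r s) (∣-∣-step′ J J′)) (s≤s bound)

  as-offset : ∀ j J′ → ∣ 2 + j - J′ ∣ ≤ 2 → ∃ λ o → J′ ≡ toℕ o + j × ∣ 2 + j - J′ ∣ ≡ offset o
  as-offset j J′ close = fromℕ< e<5 , split , (begin
    ∣ 2 + j - J′ ∣                      ≡⟨ cong₂ ∣_-_∣ (+-comm 2 j) (trans split (+-comm _ j)) ⟩
    ∣ j + 2 - j + toℕ (fromℕ< e<5) ∣    ≡⟨ ∣m+n-m+o∣≡∣n-o∣ j 2 _ ⟩
    offset (fromℕ< e<5)                 ∎)
    where
    open ≡-Reasoning
    e = J′ ∸ j
    e+j≡J′ : e + j ≡ J′
    e+j≡J′ = m∸n+n≡m (+-cancelˡ-≤ 2 j J′ (≤-trans (m≤n+∣m-n∣ (2 + j) J′)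
      (≤-trans (+-monoʳ-≤ J′ close) (≤-reflexive (+-comm J′ 2)))))
    e<5 : e < 5
    e<5 = s≤s (+-cancelʳ-≤ j e 4 (≤-trans (≤-reflexive e+j≡J′)
      (≤-trans (m≤n+∣n-m∣ J′ (2 + j))
      (≤-trans (+-monoʳ-≤ (2 + j) close) (≤-reflexive (+-comm (2 + j) 2))))))
    split : J′ ≡ toℕ (fromℕ< e<5) + j
    split = trans (sym e+j≡J′) (cong (_+ j) (sym (toℕ-fromℕ< e<5)))

  hears⇒heard : ∀ f j {r v} → Hears T f (r , (2 + j) mod n) v → Heard (window (column f) j) r
  hears⇒heard f j {r} {s , k} (0<fv , d , (p , _) , d≤fv)
    -- Values are at most 2, so a walk this short lifts from the middle column `2 + j` and stays
    -- inside the window.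
    with J′ , refl , bound ← walk-end (2 + j) (≤-trans d≤fv (m≤n⇒m≤n+o j (toℕ≤pred[n] (f (s , k))))) p
    with o , refl , eq ← as-offset j J′
           (≤-trans (m+n≤o⇒m≤o _ bound) (≤-trans d≤fv (toℕ≤pred[n] (f (s , k)))))
    = o , s , 0<fv , subst (λ e → e + d₅ r s ≤ toℕ (f (s , (toℕ o + j) mod n))) eq (≤-trans bound d≤fv)

  dominating⇒n≤cost : ∀ f → IsDominating T f → n ≤ cost T f
  dominating⇒n≤cost f dom = subst (n ≤_) (sym (cost≡∑power f))
    (periodic-cost≥ n (power ∘ column f) (twos ∘ column f)
      (λ j → cong (λ k → power (λ r → f (r , k))) ([n+m]mod-n n j))
      (2*twos≤power ∘ column f)
      (λ j → coverage (window (column f) j)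
        (λ r → hears⇒heard f j (proj₂ (dom (r , (2 + j) mod n))))))

  row-walk : ∀ {r s d k} → Walk C₅ r s d → Walk T (r , k) (s , k) d
  row-walk nil        = nil
  row-walk (cons a p) = cons (inj₁ (a , refl)) (row-walk p)

  column-walk : ∀ o j {r v d} → Walk T (r , (toℕ o + j) mod n) v d → Walk T (r , (2 + j) mod n) v (offset o + d)
  column-walk 0F j p = cons (inj₂ (refl , inj₂ (Next-mod n (1 + j)))) (cons (inj₂ (refl , inj₂ (Next-mod n j))) p)
  column-walk 1F j p = cons (inj₂ (refl , inj₂ (Next-mod n (1 + j)))) p
  column-walk 2F j p = p
  column-walk 3F j p = cons (inj₂ (refl , inj₁ (Next-mod n (2 + j)))) p
  column-walk 4F j p = cons (inj₂ (refl , inj₁ (Next-mod n (2 + j)))) (cons (inj₂ (refl , inj₁ (Next-mod n (3 + j)))) p)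

  heard⇒hears : ∀ f j {r} → Heard (window (column f) j) r → ∃ (Hears T f (r , (2 + j) mod n))
  heard⇒hears f j {r} (o , s , 0<fv , bound) = (s , (toℕ o + j) mod n) , 0<fv ,
    map₂ (map₂ (λ d≤ → ≤-trans d≤ bound))
      (walk⇒distance≤ T _∼?_ _ (column-walk o j (row-walk (d₅-walk r s))))

-- Broadcasts of cost n

HeardBelow : ℕ → (ℕ → Column) → Set
HeardBelow n x = ∀ {j} → j < n → ∀ r → Heard (window x j) r

AgreeBelow : ℕ → (x y : ℕ → Column) → Set
AgreeBelow n x y = ∀ {i} → i < n → ∀ r → x i r ≡ y i r

-- The columns n, …, n + 3 repeat the first four, so that each window of the
-- cyclic arrangement of columns 0, …, n - 1 is a window of x.
Layout : ℕ → (ℕ → Column) → Set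
Layout n x = HeardBelow n x × AgreeBelow 4 (λ i → x (n + i)) x × ∑[ i < n ] power (x (toℕ i)) ≡ n

module _ (n : ℕ) (5≤n : 5 ≤ n) {x} (layout : Layout n x) where
  open Torus n (≤-trans (m≤m+n 3 2) 5≤n)

  broadcast : TwoLimitedBroadcast T
  broadcast (r , k) = x (toℕ k) r

  unroll : ∀ {i} → i < n + 4 → ∀ r → x (i % n) r ≡ x i r
  unroll {i} i<n+4 r with i <? n
  ... | yes i<n = cong (λ k → x k r) (m<n⇒m%n≡m i<n)
  ... | no i≮n with k , refl ← m≤n⇒∃[o]m+o≡n (≮⇒≥ i≮n) =
    trans (cong (λ j → x j r) [n+k]%n≡k) (sym (proj₁ (proj₂ layout) k<4 r))
    where
    k<4 : k < 4
    k<4 = +-cancelˡ-< n k 4 i<n+4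
    [n+k]%n≡k : (n + k) % n ≡ k
    [n+k]%n≡k = trans (cong (_% n) (+-comm n k))
      (trans ([m+n]%n≡m%n k n) (m<n⇒m%n≡m (<-trans k<4 5≤n)))

  heard-window : ∀ {j} → j < n → ∀ r → Heard (window (column broadcast) j) r
  heard-window {j} j<n r with o , s , h ← proj₁ layout j<n r =
    o , s , subst (Reaches (offset o + d₅ r s)) (sym eq) h
    where
    o+j<n+4 : toℕ o + j < n + 4
    o+j<n+4 = subst (_< n + 4) (+-comm j (toℕ o)) (+-mono-<-≤ j<n (toℕ≤pred[n] o))
    eq : column broadcast (toℕ o + j) s ≡ x (toℕ o + j) s
    eq = trans (cong (λ i → x i s) (toℕ-mod n (toℕ o + j))) (unroll o+j<n+4 s)

  centred : ∀ k → ∃ λ j → j < n × (2 + j) mod n ≡ k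
  -- The window starts two columns before `k` modulo `n`; `m` adds `n ∸ 2` in place of subtracting
  -- 2.
  centred k = m % n , m%n<n m n , toℕ-injective (begin
    toℕ ((2 + m % n) mod n)   ≡⟨ toℕ-mod n (2 + m % n) ⟩
    (2 + m % n) % n           ≡⟨ suc-% n (suc (m % n)) ⟩
    suc (suc (m % n) % n) % n ≡⟨ cong (λ i → suc i % n) (suc-% n m) ⟨
    suc (suc m % n) % n       ≡⟨ suc-% n (suc m) ⟨
    (2 + m) % n               ≡⟨ cong (_% n) shift ⟩
    (toℕ k + n) % n           ≡⟨ [m+n]%n≡m%n (toℕ k) n ⟩
    toℕ k % n                 ≡⟨ m<n⇒m%n≡m (toℕ<n k) ⟩
    toℕ k                     ∎)
    where
    open ≡-Reasoning
    m = toℕ k + (n ∸ 2)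
    shift : 2 + m ≡ toℕ k + n
    shift = trans (+-comm 2 m) (trans (+-assoc (toℕ k) (n ∸ 2) 2)
      (cong (toℕ k +_) (m∸n+n≡m (≤-trans (m≤m+n 2 3) 5≤n))))

  broadcast-dominating : IsDominating T broadcast
  broadcast-dominating (r , k) with j , j<n , refl ← centred k =
    heard⇒hears broadcast j (heard-window j<n r)

  cost-broadcast : cost T broadcast ≡ n
  cost-broadcast = trans (cost≡∑power broadcast)
    (trans (sum-cong-≗ (λ j → cong (λ k → power (x (toℕ k))) (toℕ-mod-inverse n j))) (proj₂ (proj₂ layout)))

-- Explicit layouts and the insertion of blocks

∅ : Column
∅ _ = 0F

infix 6 _at_
_at_ : Fin 3 → Fin 5 → Column
(v at r) s = if does (r ≟ᶠ s) then v else 0F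

-- Columns beyond the end of the word are empty.
col : List Column → ℕ → Column
col []       _       = ∅
col (c ∷ _)  zero    = c
col (_ ∷ cs) (suc i) = col cs i

block : List Column
block = 2F at 0F ∷ ∅ ∷ 2F at 2F ∷ ∅ ∷ []

heardBelow? : ∀ n x → Dec (HeardBelow n x)
heardBelow? n x = allUpTo? (λ j → all? (heard? (window x j))) n

agreeBelow? : ∀ n x y → Dec (AgreeBelow n x y)
agreeBelow? n x y = allUpTo? (λ i → all? λ r → x i r ≟ᶠ y i r) n

layout? : ∀ n x → Dec (Layout n x)
layout? n x = heardBelow? n x ×-dec agreeBelow? 4 (λ i → x (n + i)) x ×-dec (_ ≟ n)

-- The trailing block supplies the four repeated columns, and the leading one is where a further
-- block can be attached.
BlockLayout : ℕ → Set
BlockLayout n = ∃ λ u → Layout n (col (block ++ u ++ block))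

insert-block : ∀ {n} → BlockLayout n → BlockLayout (4 + n)
insert-block {n} (u , heard , wrap , total) = block ++ u ,
  heard′ ,
  -- Past its first block the new word is the old one, and both begin with `block`.
  (λ i<4 r → trans (wrap i<4 r) (from-yes (agreeBelow? 4 (col (block ++ u ++ block)) x) i<4 r)) ,
  cong (4 +_) total
  where
  x = col (block ++ block ++ u ++ block)
  heard′ : HeardBelow (4 + n) x
  heard′ {j} j<4+n with j <? 4
  -- Such a window ends by column 7, inside the two leading blocks, so evaluation decides it for
  -- unknown `u`. Later windows are old ones moved by 4.
  ... | yes j<4 = from-yes (heardBelow? 4 x) j<4
  ... | no j≮4 with k , refl ← m≤n⇒∃[o]m+o≡n (≮⇒≥ j≮4) = λ r →
    let o , s , h = heard (+-cancelˡ-< 4 k n j<4+n) r in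
    o , s , subst (λ i → Reaches (offset o + d₅ r s) (x i s)) (shift (toℕ o) k) h
    where
    shift : ∀ o k → 4 + (o + k) ≡ o + (4 + k)
    shift = solve-∀

block-layout₅ : BlockLayout 5
block-layout₅ = u , from-yes (layout? 5 (col (block ++ u ++ block)))
  where u = 1F at 4F ∷ []

block-layout₈ : BlockLayout 8
block-layout₈ = block , from-yes (layout? 8 (col (block ++ block ++ block)))

block-layout₁₀ : BlockLayout 10
block-layout₁₀ = u , from-yes (layout? 10 (col (block ++ u ++ block)))
  where u = 1F at 4F ∷ 2F at 0F ∷ ∅ ∷ 1F at 3F ∷ 2F at 2F ∷ ∅ ∷ []

block-layout₁₁ : BlockLayout 11
block-layout₁₁ = u , from-yes (layout? 11 (col (block ++ u ++ block)))
  where u = 1F at 4F ∷ 2F at 0F ∷ ∅ ∷ 1F at 3F ∷ 2F at 2F ∷ ∅ ∷ 1F at 4F ∷ []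

block-layout : ∀ m → BlockLayout (8 + m)
-- The lengths 8, 9, 10, 11 represent all residues modulo 4.
block-layout 0 = block-layout₈
block-layout 1 = insert-block block-layout₅
block-layout 2 = block-layout₁₀
block-layout 3 = block-layout₁₁
block-layout (suc (suc (suc (suc m)))) = insert-block (block-layout m)

layout₆ : ∃ (Layout 6)
layout₆ = _ , from-yes (layout? 6 (col (w ++ take 4 w)))
  where w = 2F at 0F ∷ 1F at 1F ∷ ∅ ∷ 2F at 3F ∷ 1F at 2F ∷ ∅ ∷ []

layout₇ : ∃ (Layout 7)
layout₇ = _ , from-yes (layout? 7 (col (w ++ take 4 w)))
  where w = ∅ ∷ 1F at 4F ∷ 1F at 2F ∷ 1F at 0F ∷ ∅ ∷ 2F at 3F ∷ 2F at 1F ∷ []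

layout : ∀ m → ∃ (Layout (5 + m))
layout 0 = _ , proj₂ block-layout₅
layout 1 = layout₆
layout 2 = layout₇
layout (suc (suc (suc m))) = _ , proj₂ (block-layout m)

theorem4p5 : (n : ℕ) (5≤n : 5 ≤ n) →
    IsTwoLimitedBroadcastDominationNumber
    (Cycle 5 (m≤m+n 3 2) □ Cycle n (≤-trans (m≤m+n 3 2) 5≤n)) n
theorem4p5 n 5≤n with m , refl ← m≤n⇒∃[o]m+o≡n 5≤n =
  (broadcast n 5≤n l , broadcast-dominating n 5≤n l , cost-broadcast n 5≤n l) ,
  λ { k (f , dom , refl) → Torus.dominating⇒n≤cost n (≤-trans (m≤m+n 3 2) 5≤n) f dom }
  where l = proj₂ (layout m)
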